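{- For every $d,m\in\mathbb{N}$ we have $w_e(dm)\ge(m-3)\,w_e(d)$. In particular, \[\limsup_{d\to\infty}\frac{w_e(d)}{d}=\sup_{d\in\mathbb{N}}\frac{w_e(d)}{d}\ge1.\]
   Context: A lattice $d$-simplex in $\mathbb{R}^d$ (vertices in $\mathbb{Z}^d$) is empty if its only points of $\mathbb{Z}^d$ are its vertices. The lattice width of a convex body $K\subset\mathbb{R}^d$ is $\inf_{f\in(\mathbb{Z}^d)^*\setminus\{0\}}(\max_K f-\min_K f)$. $w_e(d)$ denotes the maximum lattice width among empty $d$-simplices. -}

module Defs where

open import Data.Nat using (ℕ; zero; suc) renaming (_≤_ to _≤ℕ_)
open import Data.Integer using (ℤ; +_; _+_; _*_; _-_; _⊔_; _⊓_; _≤_)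
open import Data.Fin using (Fin; zero; suc)
open import Data.Product using (Σ; ∃; ∃-syntax; _×_)
open import Relation.Binary.PropositionalEquality using (_≡_; _≢_)

-- A point of ℤ^d (also used for an element of the dual lattice (ℤ^d)*,
-- identified with ℤ^d via the standard dot product).
Point : ℕ → Set
Point d = Fin d → ℤ

Simplex : ℕ → Set
Simplex d = Fin (suc d) → Point d

sumℤ : (n : ℕ) → (Fin n → ℤ) → ℤ
sumℤ zero    a = + 0
sumℤ (suc n) a = a zero + sumℤ n (λ i → a (suc i))

sumℕ : (n : ℕ) → (Fin n → ℕ) → ℕ
sumℕ zero    a = 0
sumℕ (suc n) a = a zero Data.Nat.+ sumℕ n (λ i → a (suc i))

maxℤ : (n : ℕ) → (Fin (suc n) → ℤ) → ℤ
maxℤ zero    a = a zero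
maxℤ (suc n) a = a zero ⊔ maxℤ n (λ i → a (suc i))

minℤ : (n : ℕ) → (Fin (suc n) → ℤ) → ℤ
minℤ zero    a = a zero
minℤ (suc n) a = a zero ⊓ minℤ n (λ i → a (suc i))

dot : {d : ℕ} → Point d → Point d → ℤ
dot {d} f p = sumℤ d (λ j → f j * p j)

-- The d+1 vertices are affinely independent (no nontrivial affine relation;
-- over ℤ this is equivalent to over ℝ since the vertices are rational).
AffinelyIndependent : {d : ℕ} → Simplex d → Set
AffinelyIndependent {d} S =
  (a : Fin (suc d) → ℤ) → sumℤ (suc d) a ≡ + 0 →
  (∀ j → sumℤ (suc d) (λ i → a i * S i j) ≡ + 0) → ∀ i → a i ≡ + 0

IsSimplex : {d : ℕ} → Simplex d → Set
IsSimplex = AffinelyIndependent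

-- p lies in the convex hull of the vertices: p = Σ (c i / N) S i with
-- c i ∈ ℕ, N = Σ c i > 0 (rational convex coefficients, written with a
-- common denominator; for a lattice point of a lattice simplex the
-- barycentric coordinates are necessarily rational).
InSimplex : {d : ℕ} → Simplex d → Point d → Set
InSimplex {d} S p =
  Σ (Fin (suc d) → ℕ) λ c →
    (sumℕ (suc d) c ≢ 0) ×
    (∀ j → (+ sumℕ (suc d) c) * p j ≡ sumℤ (suc d) (λ i → (+ c i) * S i j))

IsEmpty : {d : ℕ} → Simplex d → Set
IsEmpty {d} S = (p : Point d) → InSimplex S p → ∃[ i ] (∀ j → S i j ≡ p j)

NonZeroFunctional : {d : ℕ} → Point d → Set
NonZeroFunctional f = ∃[ j ] (f j ≢ + 0)

-- max_K f - min_K f for K = conv(S) (attained at vertices)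
range : {d : ℕ} → Point d → Simplex d → ℤ
range {d} f S = maxℤ d (λ i → dot f (S i)) - minℤ d (λ i → dot f (S i))

HasWidth : {d : ℕ} → Simplex d → ℕ → Set
HasWidth {d} S w =
  (∃[ f ] (NonZeroFunctional f × range f S ≡ + w)) ×
  (∀ (f : Point d) → NonZeroFunctional f → + w ≤ range f S)

IsMaxEmptyWidth : ℕ → ℕ → Set
IsMaxEmptyWidth d w =
  (∃[ S ] (IsSimplex {d} S × IsEmpty S × HasWidth S w)) ×
  (∀ (S : Simplex d) (w' : ℕ) → IsSimplex S → IsEmpty S → HasWidth S w' → w' ≤ℕ w)

{-# OPTIONS --safe #-}
module Submission where

-- Translate S so that one vertex is 0 and let u_j be the others. In m blocks of ℤ^d take the simplex
-- with vertices 0 and k u_j in block i plus u_j in block i + 1 (cyclically), where k = m - 2. A convex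
-- combination with weight Λ_i on block i restricts on each block to a combination of the u_j of
-- weight k Λ_i + Λ_(i-1); these weights sum to at most k + 1 < m, so some block has weight < 1, hence
-- vanishes for a lattice point since S is empty, and walking around the cycle leaves only the vertices.
-- A functional f with blocks f_i takes the values k f_i + f_(i+1) on the u_j, so choosing i
-- with the largest range gives width at least (k - 1) w = (m - 3) w.
-- Letting m grow gives the limit statements, the lower bound 1 coming from d = 1.

open import Defs
open import Data.Nat using (ℕ; _+_; _*_; _∸_; _≤_; _<_)
open import Data.Product using (_×_; ∃-syntax)

open import Algebra.Bundles using (CommutativeMonoid)
import Algebra.Properties.CommutativeMonoid.Sum as CMSum
import Algebra.Properties.Semiring.Sum as SemiringSum
open import Data.Empty using (⊥-elim)
open import Data.Fin using (Fin; zero; suc; inject₁; combine; remQuot; punchIn; _↑ˡ_; _↑ʳ_)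
open import Data.Fin.Induction using (<-weakInduction; >-weakInduction)
open import Data.Fin.Permutation using (Permutation′; _⟨$⟩ʳ_; _⟨$⟩ˡ_; _∘ₚ_; lift₀; reverse; inverseˡ; inverseʳ)
open import Data.Fin.Properties using (_≟_; any?; ¬∀⟶∃¬; punchInᵢ≢i; remQuot-combine; combine-remQuot; opposite-involutive)
open import Data.Integer as ℤ using (ℤ; +_; ∣_∣; 0ℤ; 1ℤ)
import Data.Integer.Properties as ℤₚ
import Data.Integer.Tactic.RingSolver as ℤ-Solver
open import Data.Nat as ℕ using (zero; suc; s≤s; z≤n; NonZero)
open import Data.Nat.Induction using (<-rec)
import Data.Nat.Properties as ℕₚ
import Data.Nat.Tactic.RingSolver as ℕ-Solver
open import Data.Product using (∃; _,_; proj₁; proj₂; uncurry)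
open import Data.Sum using (_⊎_; inj₁; inj₂; [_,_]′)
open import Data.Vec.Functional using (Vector; removeAt)
open import Function using (_∘_)
open import Relation.Binary.PropositionalEquality
open import Relation.Nullary using (¬_; Dec; yes; no; contradiction)
open import Relation.Nullary.Decidable using (decidable-stable)
open import Algebra.Properties.AbelianGroup ℤₚ.+-0-abelianGroup using (inverseˡ-unique)

-- Finite sums over ℤ and ℕ.

module Sumℤ = SemiringSum ℤₚ.+-*-semiring
module Sumℕ = SemiringSum ℕₚ.+-*-semiring

open Sumℤ using () renaming (sum to ∑)
open Sumℕ using () renaming (sum to ∑ℕ)

-- Generic in the monoid because sums over blocks occur both over ℤ, for coordinates, and over ℕ,
-- for convex weights.
module BlockSum {c ℓ} (M : CommutativeMonoid c ℓ) where
  open CommutativeMonoid M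
    renaming (_∙_ to _⊕_; refl to ≈-refl; sym to ≈-sym; trans to ≈-trans; setoid to ≈-setoid)
  open CMSum M

  sum-++ : ∀ m {n} (t : Vector Carrier (m + n)) →
           sum t ≈ sum (λ i → t (i ↑ˡ n)) ⊕ sum (λ j → t (m ↑ʳ j))
  sum-++ zero    t = ≈-sym (identityˡ _)
  sum-++ (suc m) t = ≈-trans (∙-congˡ (sum-++ m (t ∘ suc))) (≈-sym (assoc _ _ _))

  sum-combine : ∀ m {n} (t : Vector Carrier (m * n)) →
                sum t ≈ sum (λ i → sum (λ j → t (combine {m} i j)))
  sum-combine zero        t = ≈-refl
  sum-combine (suc m) {n} t = ≈-trans (sum-++ n t) (∙-congˡ (sum-combine m (λ x → t (n ↑ʳ x))))

  sum-only : ∀ {n} (t : Vector Carrier n) i → (∀ j → j ≢ i → t j ≈ ε) → sum t ≈ t i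
  sum-only {suc n} t i t≈ε = begin
    sum t                       ≈⟨ sum-remove t ⟩
    t i ⊕ sum (removeAt t i)    ≈⟨ ∙-congˡ (sum-cong-≋ λ j → t≈ε (punchIn i j) (punchInᵢ≢i i j)) ⟩
    t i ⊕ sum {n} (λ _ → ε)     ≈⟨ ∙-congˡ (sum-replicate-zero n) ⟩
    t i ⊕ ε                     ≈⟨ identityʳ _ ⟩
    t i                         ∎
    where open import Relation.Binary.Reasoning.Setoid ≈-setoid

open BlockSum ℤₚ.+-0-commutativeMonoid
open BlockSum ℕₚ.+-0-commutativeMonoid using ()
  renaming (sum-combine to sumℕ-combine)

sumℤ≡∑ : ∀ n (a : Fin n → ℤ) → sumℤ n a ≡ ∑ a
sumℤ≡∑ zero    a = refl
sumℤ≡∑ (suc n) a = cong (λ z → a zero ℤ.+ z) (sumℤ≡∑ n (a ∘ suc))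

sumℕ≡∑ : ∀ n (a : Fin n → ℕ) → sumℕ n a ≡ ∑ℕ a
sumℕ≡∑ zero    a = refl
sumℕ≡∑ (suc n) a = cong (λ s → a zero + s) (sumℕ≡∑ n (a ∘ suc))

∑-+ : ∀ {n} (a : Fin n → ℕ) → + ∑ℕ a ≡ ∑ (λ i → + a i)
∑-+ {zero}  a = refl
∑-+ {suc n} a = cong (λ z → + a zero ℤ.+ z) (∑-+ (a ∘ suc))

∑-zero : ∀ {n} (t : Fin n → ℤ) → (∀ i → t i ≡ 0ℤ) → ∑ t ≡ 0ℤ
∑-zero {n} t t≡0 = trans (Sumℤ.sum-cong-≗ t≡0) (Sumℤ.sum-replicate-zero n)

∑-*ʳ-minus : ∀ {n} (a s : Fin n → ℤ) (r : ℤ) →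
             ∑ (λ i → a i ℤ.* (s i ℤ.- r)) ≡ ∑ (λ i → a i ℤ.* s i) ℤ.- ∑ a ℤ.* r
∑-*ʳ-minus {zero}  a s r = refl
∑-*ʳ-minus {suc n} a s r =
  trans (cong (λ z → a zero ℤ.* (s zero ℤ.- r) ℤ.+ z) (∑-*ʳ-minus (a ∘ suc) (s ∘ suc) r))
        (lemma (a zero) (s zero) r (∑ (λ i → a (suc i) ℤ.* s (suc i))) (∑ (a ∘ suc)))
  where
  lemma : ∀ a₀ s₀ r Y A → a₀ ℤ.* (s₀ ℤ.- r) ℤ.+ (Y ℤ.- A ℤ.* r)
                        ≡ (a₀ ℤ.* s₀ ℤ.+ Y) ℤ.- (a₀ ℤ.+ A) ℤ.* r
  lemma = ℤ-Solver.solve-∀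

∑-minus : ∀ {n} (s t : Fin n → ℤ) → ∑ (λ i → s i ℤ.- t i) ≡ ∑ s ℤ.- ∑ t
∑-minus {zero}  s t = refl
∑-minus {suc n} s t =
  trans (cong (λ z → s zero ℤ.- t zero ℤ.+ z) (∑-minus (s ∘ suc) (t ∘ suc)))
        (lemma (s zero) (t zero) (∑ (s ∘ suc)) (∑ (t ∘ suc)))
  where
  lemma : ∀ a b c d → (a ℤ.- b) ℤ.+ (c ℤ.- d) ≡ (a ℤ.+ c) ℤ.- (b ℤ.+ d)
  lemma = ℤ-Solver.solve-∀

term≤∑ℕ : ∀ {n} (t : Fin n → ℕ) i → t i ≤ ∑ℕ t
term≤∑ℕ t zero    = ℕₚ.m≤m+n _ _
term≤∑ℕ t (suc i) = ℕₚ.≤-trans (term≤∑ℕ (t ∘ suc) i) (ℕₚ.m≤n+m _ _)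

*-≤-∑ℕ : ∀ {n} (t : Fin n → ℕ) {b} → (∀ i → b ≤ t i) → n * b ≤ ∑ℕ t
*-≤-∑ℕ {zero}  t b≤t = z≤n
*-≤-∑ℕ {suc n} t b≤t = ℕₚ.+-mono-≤ (b≤t zero) (*-≤-∑ℕ (t ∘ suc) (b≤t ∘ suc))

∑ℕ-full-term : ∀ {n} (t : Fin n → ℕ) i → t i ≡ ∑ℕ t → ∀ j → j ≢ i → t j ≡ 0
∑ℕ-full-term t zero full zero    j≢i = contradiction refl j≢i
∑ℕ-full-term t zero full (suc j) j≢i = ℕₚ.n≤0⇒n≡0 (ℕₚ.≤-trans (term≤∑ℕ (t ∘ suc) j) rest≤0)
  where
  rest≤0 : ∑ℕ (t ∘ suc) ≤ 0
  rest≤0 = ℕₚ.+-cancelˡ-≤ (t zero) _ _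
    (ℕₚ.≤-reflexive (trans (sym full) (sym (ℕₚ.+-identityʳ (t zero)))))
∑ℕ-full-term t (suc i) full j j≢i with ℕₚ.+-cancelʳ-≤ (∑ℕ (t ∘ suc)) (t zero) 0
  (ℕₚ.≤-trans (ℕₚ.≤-reflexive (sym full)) (term≤∑ℕ (t ∘ suc) i))
... | t₀≤0 with ℕₚ.n≤0⇒n≡0 t₀≤0
∑ℕ-full-term t (suc i) full zero    j≢i | _ | t₀≡0 = t₀≡0
∑ℕ-full-term t (suc i) full (suc j) j≢i | _ | t₀≡0 =
  ∑ℕ-full-term (t ∘ suc) i (trans full (cong (_+ ∑ℕ (t ∘ suc)) t₀≡0)) j (j≢i ∘ cong suc)

𝟙 : {P : Set} → Dec P → ℤ
𝟙 (yes _) = 1ℤ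
𝟙 (no _)  = 0ℤ

-- A predicate with a unique witness, rather than equality with `i`, also covers conditions such as
-- `π ⟨$⟩ʳ i′ ≟ i`, whose witness is a preimage.
∑-𝟙 : ∀ {n} {P : Fin n → Set} (P? : ∀ j → Dec (P j)) (g : Fin n → ℤ) i →
      P i → (∀ j → P j → j ≡ i) → ∑ (λ j → 𝟙 (P? j) ℤ.* g j) ≡ g i
∑-𝟙 P? g i Pi unique = trans (sum-only _ i off) on
  where
  off : ∀ j → j ≢ i → 𝟙 (P? j) ℤ.* g j ≡ 0ℤ
  off j j≢i with P? j
  ... | yes Pj = contradiction (unique j Pj) j≢i
  ... | no _   = ℤₚ.*-zeroˡ (g j)
  on : 𝟙 (P? i) ℤ.* g i ≡ g i
  on with P? i
  ... | yes _  = ℤₚ.*-identityˡ (g i)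
  ... | no ¬Pi = contradiction Pi ¬Pi

-- Extreme values and the range of a functional.

maxℤ-attained : ∀ n (a : Fin (suc n) → ℤ) → ∃[ i ] maxℤ n a ≡ a i
maxℤ-attained zero    a = zero , refl
maxℤ-attained (suc n) a with ℤₚ.⊔-sel (a zero) (maxℤ n (a ∘ suc)) | maxℤ-attained n (a ∘ suc)
... | inj₁ eq | _        = zero , eq
... | inj₂ eq | i , eq′  = suc i , trans eq eq′

minℤ-attained : ∀ n (a : Fin (suc n) → ℤ) → ∃[ i ] minℤ n a ≡ a i
minℤ-attained zero    a = zero , refl
minℤ-attained (suc n) a with ℤₚ.⊓-sel (a zero) (minℤ n (a ∘ suc)) | minℤ-attained n (a ∘ suc)
... | inj₁ eq | _        = zero , eq
... | inj₂ eq | i , eq′  = suc i , trans eq eq′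

≤-maxℤ : ∀ n (a : Fin (suc n) → ℤ) i → a i ℤ.≤ maxℤ n a
≤-maxℤ zero    a zero    = ℤₚ.≤-refl
≤-maxℤ (suc n) a zero    = ℤₚ.i≤i⊔j _ _
≤-maxℤ (suc n) a (suc i) = ℤₚ.≤-trans (≤-maxℤ n (a ∘ suc) i) (ℤₚ.i≤j⊔i _ _)

minℤ-≤ : ∀ n (a : Fin (suc n) → ℤ) i → minℤ n a ℤ.≤ a i
minℤ-≤ zero    a zero    = ℤₚ.≤-refl
minℤ-≤ (suc n) a zero    = ℤₚ.i⊓j≤i _ _
minℤ-≤ (suc n) a (suc i) = ℤₚ.≤-trans (ℤₚ.i⊓j≤j _ _) (minℤ-≤ n (a ∘ suc) i)

range-attained : ∀ {d} (f : Point d) (S : Simplex d) →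
                 ∃[ a ] ∃[ b ] range f S ≡ dot f (S a) ℤ.- dot f (S b)
range-attained {d} f S =
  let a , eqa = maxℤ-attained d (λ i → dot f (S i))
      b , eqb = minℤ-attained d (λ i → dot f (S i))
  in a , b , cong₂ ℤ._-_ eqa eqb

difference≤range : ∀ {d} (f : Point d) (S : Simplex d) a b →
                   dot f (S a) ℤ.- dot f (S b) ℤ.≤ range f S
difference≤range {d} f S a b =
  ℤₚ.+-mono-≤ (≤-maxℤ d (λ i → dot f (S i)) a) (ℤₚ.neg-mono-≤ (minℤ-≤ d (λ i → dot f (S i)) b))

range≡+∣range∣ : ∀ {d} (f : Point d) (S : Simplex d) → range f S ≡ + ∣ range f S ∣
range≡+∣range∣ f S = sym (ℤₚ.0≤i⇒+∣i∣≡i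
  (subst (ℤ._≤ range f S) (ℤₚ.+-inverseʳ (dot f (S zero))) (difference≤range f S zero zero)))

+-then-minus : ∀ x y → x ≡ (x ℤ.+ y) ℤ.- y
+-then-minus = ℤ-Solver.solve-∀

-- Edge vectors at the base vertex.

edge : ∀ {d} → Simplex d → Fin d → Point d
edge S i l = S (suc i) l ℤ.- S zero l

dot-edge : ∀ {d} (f : Point d) (S : Simplex d) i →
           dot f (edge S i) ≡ dot f (S (suc i)) ℤ.- dot f (S zero)
dot-edge {d} f S i = begin
  dot f (edge S i)                                            ≡⟨ sumℤ≡∑ d _ ⟩
  ∑ (λ l → f l ℤ.* (S (suc i) l ℤ.- S zero l))                ≡⟨ Sumℤ.sum-cong-≗ (λ l → distrib (f l) _ _) ⟩
  ∑ (λ l → f l ℤ.* S (suc i) l ℤ.- f l ℤ.* S zero l)          ≡⟨ ∑-minus {d} _ _ ⟩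
  ∑ (λ l → f l ℤ.* S (suc i) l) ℤ.- ∑ (λ l → f l ℤ.* S zero l) ≡⟨ cong₂ ℤ._-_ (sumℤ≡∑ d _) (sumℤ≡∑ d _) ⟨
  dot f (S (suc i)) ℤ.- dot f (S zero)                        ∎
  where
  open ≡-Reasoning
  distrib : ∀ x y z → x ℤ.* (y ℤ.- z) ≡ x ℤ.* y ℤ.- x ℤ.* z
  distrib = ℤ-Solver.solve-∀

-- Giving the base vertex the coefficient `ℤ.- ∑ a` turns a linear relation between edges into an
-- affine relation between vertices.
edge-independent : ∀ {d} (S : Simplex d) → IsSimplex S → (a : Fin d → ℤ) →
                   (∀ l → ∑ (λ i → a i ℤ.* edge S i l) ≡ 0ℤ) → ∀ i → a i ≡ 0ℤ
edge-independent {d} S simplex a a⊥ i = simplex a′ sum≡0 comb≡0 (suc i)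
  where
  open ≡-Reasoning
  a′ : Fin (suc d) → ℤ
  a′ zero    = ℤ.- ∑ a
  a′ (suc i) = a i
  sum≡0 : sumℤ (suc d) a′ ≡ 0ℤ
  sum≡0 = trans (cong (λ z → ℤ.- ∑ a ℤ.+ z) (sumℤ≡∑ d a)) (ℤₚ.+-inverseˡ (∑ a))
  rearrange : ∀ A r Y → (ℤ.- A) ℤ.* r ℤ.+ Y ≡ Y ℤ.- A ℤ.* r
  rearrange = ℤ-Solver.solve-∀
  comb≡0 : ∀ l → sumℤ (suc d) (λ i → a′ i ℤ.* S i l) ≡ 0ℤ
  comb≡0 l = begin
    ℤ.- ∑ a ℤ.* S zero l ℤ.+ sumℤ d (λ i → a i ℤ.* S (suc i) l)  ≡⟨ cong (λ z → ℤ.- ∑ a ℤ.* S zero l ℤ.+ z) (sumℤ≡∑ d _) ⟩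
    ℤ.- ∑ a ℤ.* S zero l ℤ.+ ∑ (λ i → a i ℤ.* S (suc i) l)       ≡⟨ rearrange (∑ a) (S zero l) _ ⟩
    ∑ (λ i → a i ℤ.* S (suc i) l) ℤ.- ∑ a ℤ.* S zero l           ≡⟨ ∑-*ʳ-minus a (λ i → S (suc i) l) (S zero l) ⟨
    ∑ (λ i → a i ℤ.* edge S i l)                                 ≡⟨ a⊥ l ⟩
    0ℤ                                                           ∎

-- The missing weight N ∸ ∑ℕ c goes to the vertex S zero.
edge-empty : ∀ {d} (S : Simplex d) → IsSimplex S → IsEmpty S →
             ∀ N (c : Fin d → ℕ) (q : Point d) → N ≢ 0 → ∑ℕ c ≤ N →
             (∀ l → + N ℤ.* q l ≡ ∑ (λ i → + c i ℤ.* edge S i l)) →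
             (∀ i → c i ≡ 0) ⊎ (∃[ i ] c i ≡ N)
edge-empty {d} S simplex empty N c q N≢0 ∑c≤N Nq≡ with empty p (c′ , sum≢0 , inHull)
  where
  open ≡-Reasoning
  c′ : Fin (suc d) → ℕ
  c′ zero    = N ∸ ∑ℕ c
  c′ (suc i) = c i
  p : Point d
  p l = q l ℤ.+ S zero l
  sum≡N : sumℕ (suc d) c′ ≡ N
  sum≡N = trans (cong (λ s → N ∸ ∑ℕ c + s) (sumℕ≡∑ d c)) (ℕₚ.m∸n+n≡m ∑c≤N)
  sum≢0 : sumℕ (suc d) c′ ≢ 0
  sum≢0 = N≢0 ∘ trans (sym sum≡N)
  complement : + (N ∸ ∑ℕ c) ≡ + N ℤ.- ∑ (λ i → + c i)
  complement = trans (trans (sym (ℤₚ.⊖-≥ ∑c≤N)) (sym (ℤₚ.m-n≡m⊖n N (∑ℕ c))))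
                     (cong (λ s → + N ℤ.- s) (∑-+ c))
  rearrange : ∀ n q s A Y → n ℤ.* q ≡ Y ℤ.- A ℤ.* s →
              n ℤ.* (q ℤ.+ s) ≡ (n ℤ.- A) ℤ.* s ℤ.+ Y
  rearrange n q s A Y eq = trans (ℤₚ.*-distribˡ-+ n q s)
    (trans (cong (λ z → z ℤ.+ n ℤ.* s) eq) (regroup n s A Y))
    where
    regroup : ∀ n s A Y → (Y ℤ.- A ℤ.* s) ℤ.+ n ℤ.* s ≡ (n ℤ.- A) ℤ.* s ℤ.+ Y
    regroup = ℤ-Solver.solve-∀
  inHull : ∀ l → + sumℕ (suc d) c′ ℤ.* p l ≡ sumℤ (suc d) (λ i → + c′ i ℤ.* S i l)
  inHull l = begin
    + sumℕ (suc d) c′ ℤ.* p l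
      ≡⟨ cong (λ s → + s ℤ.* p l) sum≡N ⟩
    + N ℤ.* (q l ℤ.+ S zero l)
      ≡⟨ rearrange (+ N) (q l) (S zero l) (∑ (λ i → + c i)) _
           (trans (Nq≡ l) (∑-*ʳ-minus (λ i → + c i) (λ i → S (suc i) l) (S zero l))) ⟩
    (+ N ℤ.- ∑ (λ i → + c i)) ℤ.* S zero l ℤ.+ ∑ (λ i → + c i ℤ.* S (suc i) l)
      ≡⟨ cong₂ (λ x y → x ℤ.* S zero l ℤ.+ y) complement (sumℤ≡∑ d _) ⟨
    + (N ∸ ∑ℕ c) ℤ.* S zero l ℤ.+ sumℤ d (λ i → + c i ℤ.* S (suc i) l) ∎
-- If `p` is the base vertex, then `q` is 0 and `c` is a linear relation between the edges.
... | zero , S₀≡p = inj₁ λ i → ℤₚ.+-injective (edge-independent S simplex (λ i → + c i) c⊥ i)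
  where
  q≡0 : ∀ l → q l ≡ 0ℤ
  q≡0 l = trans (+-then-minus (q l) (S zero l)) (ℤₚ.i≡j⇒i-j≡0 (sym (S₀≡p l)))
  c⊥ : ∀ l → ∑ (λ i → + c i ℤ.* edge S i l) ≡ 0ℤ
  c⊥ l = trans (sym (Nq≡ l)) (trans (cong (+ N ℤ.*_) (q≡0 l)) (ℤₚ.*-zeroʳ (+ N)))
... | suc i , Sᵢ≡p = inj₂ (i , ℤₚ.+-injective (ℤₚ.i-j≡0⇒i≡j _ _ cᵢ-N≡0))
  where
  open ≡-Reasoning
  q≡edge : ∀ l → q l ≡ edge S i l
  q≡edge l = trans (+-then-minus (q l) (S zero l)) (cong (ℤ._- S zero l) (sym (Sᵢ≡p l)))
  -- Now `q` is the edge `i`, so subtracting `N` times the unit vector at `i` from `c` gives a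
  -- linear relation between the edges; its entry at `i` says that `c i` is `N`.
  a : Fin d → ℤ
  a j = + c j ℤ.- 𝟙 (i ≟ j) ℤ.* + N
  distrib : ∀ c δ n e → (c ℤ.- δ ℤ.* n) ℤ.* e ≡ c ℤ.* e ℤ.- δ ℤ.* (n ℤ.* e)
  distrib = ℤ-Solver.solve-∀
  a⊥ : ∀ l → ∑ (λ j → a j ℤ.* edge S j l) ≡ 0ℤ
  a⊥ l = begin
    ∑ (λ j → a j ℤ.* edge S j l)
      ≡⟨ Sumℤ.sum-cong-≗ (λ j → distrib (+ c j) (𝟙 (i ≟ j)) (+ N) (edge S j l)) ⟩
    ∑ (λ j → + c j ℤ.* edge S j l ℤ.- 𝟙 (i ≟ j) ℤ.* (+ N ℤ.* edge S j l))
      ≡⟨ ∑-minus {d} _ _ ⟩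
    ∑ (λ j → + c j ℤ.* edge S j l) ℤ.- ∑ (λ j → 𝟙 (i ≟ j) ℤ.* (+ N ℤ.* edge S j l))
      ≡⟨ cong₂ ℤ._-_ (sym (Nq≡ l)) (∑-𝟙 (i ≟_) (λ j → + N ℤ.* edge S j l) i refl (λ _ → sym)) ⟩
    + N ℤ.* q l ℤ.- + N ℤ.* edge S i l
      ≡⟨ cong (λ x → + N ℤ.* x ℤ.- + N ℤ.* edge S i l) (q≡edge l) ⟩
    + N ℤ.* edge S i l ℤ.- + N ℤ.* edge S i l
      ≡⟨ ℤₚ.+-inverseʳ (+ N ℤ.* edge S i l) ⟩
    0ℤ ∎
  diagonal : 𝟙 (i ≟ i) ℤ.* + N ≡ + N
  diagonal with i ≟ i
  ... | yes _   = ℤₚ.*-identityˡ (+ N)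
  ... | no i≢i  = contradiction refl i≢i
  cᵢ-N≡0 : + c i ℤ.- + N ≡ 0ℤ
  cᵢ-N≡0 = trans (cong (λ x → + c i ℤ.- x) (sym diagonal)) (edge-independent S simplex a a⊥ i)

-- A cyclic permutation of the blocks.

-- Two reflections compose to a rotation: each index moves down by one and `zero` goes to the last
-- index.
cycle : ∀ n → Permutation′ (suc n)
cycle n = lift₀ reverse ∘ₚ reverse

cycle-suc : ∀ {n} (i : Fin n) → cycle n ⟨$⟩ʳ suc i ≡ inject₁ i
cycle-suc i = cong inject₁ (opposite-involutive i)

-- Transitivity of the action generated by `π`, phrased as an induction principle so that no
-- iterates of `π` have to be counted.
Transitive : ∀ {m} → Permutation′ m → Set₁
Transitive {m} π = (P : Fin m → Set) → (∀ i → P i → P (π ⟨$⟩ʳ i)) → ∀ i → P i → ∀ j → P j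

-- Descend from `i` to `zero`, wrap around to the last index with one more step, and descend from
-- there to any index.
cycle-transitive : ∀ n → Transitive (cycle n)
cycle-transitive n P step i Pi =
  >-weakInduction P (step zero (descend i Pi)) predecessor
  where
  predecessor : ∀ i → P (suc i) → P (inject₁ i)
  predecessor i = subst P (cycle-suc i) ∘ step (suc i)
  descend : ∀ i → P i → P zero
  descend = <-weakInduction (λ i → P i → P zero) (λ P₀ → P₀) (λ i P₀ → P₀ ∘ predecessor i)

-- The blow-up, its combinations and its functionals.

-- Serves both the rows of `coupling`, with `q` the image of `p` under `π`, and its columns, with
-- `q` the preimage.
∑-weighted-𝟙 : ∀ {n} {P Q : Fin n → Set} (P? : ∀ j → Dec (P j)) (Q? : ∀ j → Dec (Q j)) k
               (g : Fin n → ℤ) p q → P p → (∀ j → P j → j ≡ p) → Q q → (∀ j → Q j → j ≡ q) →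
               ∑ (λ j → (k ℤ.* 𝟙 (P? j) ℤ.+ 𝟙 (Q? j)) ℤ.* g j) ≡ k ℤ.* g p ℤ.+ g q
∑-weighted-𝟙 {n} P? Q? k g p q Pp P! Qq Q! = begin
  ∑ (λ j → (k ℤ.* 𝟙 (P? j) ℤ.+ 𝟙 (Q? j)) ℤ.* g j)
    ≡⟨ Sumℤ.sum-cong-≗ (λ j → distrib k (𝟙 (P? j)) (𝟙 (Q? j)) (g j)) ⟩
  ∑ (λ j → 𝟙 (P? j) ℤ.* (k ℤ.* g j) ℤ.+ 𝟙 (Q? j) ℤ.* g j)
    ≡⟨ Sumℤ.∑-distrib-+ {n} _ _ ⟩
  ∑ (λ j → 𝟙 (P? j) ℤ.* (k ℤ.* g j)) ℤ.+ ∑ (λ j → 𝟙 (Q? j) ℤ.* g j)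
    ≡⟨ cong₂ ℤ._+_ (∑-𝟙 P? (λ j → k ℤ.* g j) p Pp P!) (∑-𝟙 Q? g q Qq Q!) ⟩
  k ℤ.* g p ℤ.+ g q ∎
  where
  open ≡-Reasoning
  distrib : ∀ k x y g → (k ℤ.* x ℤ.+ y) ℤ.* g ≡ x ℤ.* (k ℤ.* g) ℤ.+ y ℤ.* g
  distrib = ℤ-Solver.solve-∀

-- The matrix `k` times the identity plus the permutation matrix of `π`. The nonzero vertices of the
-- blow-up form its Kronecker product with the edge matrix of `S`.
coupling : ∀ {m} → Permutation′ m → ℕ → Fin m → Fin m → ℤ
coupling π k i′ i = + k ℤ.* 𝟙 (i′ ≟ i) ℤ.+ 𝟙 (π ⟨$⟩ʳ i′ ≟ i)

blowUpEntry : ∀ {d m} → Permutation′ m → ℕ → Simplex d → Fin d × Fin m → Fin d × Fin m → ℤ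
blowUpEntry π k S (j , i) (l , i′) = coupling π k i′ i ℤ.* edge S j l

-- ℤ^(dm) is split into m blocks ℤ^d; the vertex with index (j , i) is k times the edge vector j in
-- block i plus the same edge vector in block π⁻¹ i.
blowUp : ∀ {d m} → Permutation′ m → ℕ → Simplex d → Simplex (d * m)
blowUp         π k S zero    y = 0ℤ
blowUp {d} {m} π k S (suc x) y = blowUpEntry π k S (remQuot {d} m x) (remQuot {d} m y)

block : ∀ {d m} → Point (d * m) → Fin m → Point d
block f i l = f (combine l i)

module _ {d m} (π : Permutation′ m) (k : ℕ) (S : Simplex d) where

  private
    rotate : ∀ b c e → b ℤ.* (c ℤ.* e) ≡ c ℤ.* (b ℤ.* e)
    rotate = ℤ-Solver.solve-∀

  blowUp-combine : ∀ (j : Fin d) i l i′ →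
                   blowUp π k S (suc (combine j i)) (combine l i′) ≡ coupling π k i′ i ℤ.* edge S j l
  blowUp-combine j i l i′ = cong₂ (blowUpEntry π k S) (remQuot-combine {d} j i) (remQuot-combine {d} l i′)

  -- Row `i′` of `coupling` picks out the blocks `i′` and `π ⟨$⟩ʳ i′`. What remains is a combination
  -- of the edges of `S`, to which hypotheses on `S` apply.
  blowUp-combination : ∀ (b : Fin (d * m) → ℤ) l i′ →
    ∑ (λ x → b x ℤ.* blowUp π k S (suc x) (combine l i′)) ≡
    ∑ (λ j → (+ k ℤ.* b (combine j i′) ℤ.+ b (combine j (π ⟨$⟩ʳ i′))) ℤ.* edge S j l)
  blowUp-combination b l i′ = trans (sum-combine d _) (Sumℤ.sum-cong-≗ perEdge)
    where
    open ≡-Reasoning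
    factor : ∀ k x y e → k ℤ.* (x ℤ.* e) ℤ.+ y ℤ.* e ≡ (k ℤ.* x ℤ.+ y) ℤ.* e
    factor = ℤ-Solver.solve-∀
    perEdge : ∀ j → ∑ (λ i → b (combine j i) ℤ.* blowUp π k S (suc (combine j i)) (combine l i′)) ≡
                    (+ k ℤ.* b (combine j i′) ℤ.+ b (combine j (π ⟨$⟩ʳ i′))) ℤ.* edge S j l
    perEdge j = begin
      ∑ (λ i → b (combine j i) ℤ.* blowUp π k S (suc (combine j i)) (combine l i′))
        ≡⟨ Sumℤ.sum-cong-≗ (λ i → trans (cong (b (combine j i) ℤ.*_) (blowUp-combine j i l i′))
                                         (rotate (b (combine j i)) (coupling π k i′ i) (edge S j l))) ⟩
      ∑ (λ i → coupling π k i′ i ℤ.* (b (combine j i) ℤ.* edge S j l))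
        ≡⟨ ∑-weighted-𝟙 (i′ ≟_) (π ⟨$⟩ʳ i′ ≟_) (+ k) (λ i → b (combine j i) ℤ.* edge S j l)
             i′ (π ⟨$⟩ʳ i′) refl (λ _ → sym) refl (λ _ → sym) ⟩
      + k ℤ.* (b (combine j i′) ℤ.* edge S j l) ℤ.+ b (combine j (π ⟨$⟩ʳ i′)) ℤ.* edge S j l
        ≡⟨ factor (+ k) (b (combine j i′)) (b (combine j (π ⟨$⟩ʳ i′))) (edge S j l) ⟩
      (+ k ℤ.* b (combine j i′) ℤ.+ b (combine j (π ⟨$⟩ʳ i′))) ℤ.* edge S j l ∎

  -- The dual computation, by columns of `coupling`; hence the inverse of `π`.
  dot-blowUp : ∀ (f : Point (d * m)) j i →
    dot f (blowUp π k S (suc (combine j i))) ≡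
    + k ℤ.* dot (block f i) (edge S j) ℤ.+ dot (block f (π ⟨$⟩ˡ i)) (edge S j)
  dot-blowUp f j i = begin
    dot f (blowUp π k S (suc (combine j i)))
      ≡⟨ trans (sumℤ≡∑ (d * m) _) (sum-combine d _) ⟩
    ∑ (λ (l : Fin d) → ∑ (λ i′ → f (combine l i′) ℤ.* blowUp π k S (suc (combine j i)) (combine l i′)))
      ≡⟨ Sumℤ.sum-cong-≗ perCoordinate ⟩
    ∑ (λ l → + k ℤ.* summand i l ℤ.+ summand (π ⟨$⟩ˡ i) l)
      ≡⟨ Sumℤ.∑-distrib-+ {d} _ _ ⟩
    ∑ (λ l → + k ℤ.* summand i l) ℤ.+ ∑ (summand (π ⟨$⟩ˡ i))
      ≡⟨ cong (λ z → z ℤ.+ ∑ (summand (π ⟨$⟩ˡ i))) (Sumℤ.*-distribˡ-sum (+ k) (summand i)) ⟨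
    + k ℤ.* ∑ (summand i) ℤ.+ ∑ (summand (π ⟨$⟩ˡ i))
      ≡⟨ cong₂ (λ x y → + k ℤ.* x ℤ.+ y) (sumℤ≡∑ d _) (sumℤ≡∑ d _) ⟨
    + k ℤ.* dot (block f i) (edge S j) ℤ.+ dot (block f (π ⟨$⟩ˡ i)) (edge S j) ∎
    where
    open ≡-Reasoning
    summand : Fin m → Fin d → ℤ
    summand i l = f (combine l i) ℤ.* edge S j l
    perCoordinate : ∀ l → ∑ (λ i′ → f (combine l i′) ℤ.* blowUp π k S (suc (combine j i)) (combine l i′)) ≡
                          + k ℤ.* summand i l ℤ.+ summand (π ⟨$⟩ˡ i) l
    perCoordinate l = trans
      (Sumℤ.sum-cong-≗ (λ i′ → trans (cong (f (combine l i′) ℤ.*_) (blowUp-combine j i l i′))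
                                     (rotate (f (combine l i′)) (coupling π k i′ i) (edge S j l))))
      (∑-weighted-𝟙 (_≟ i) (λ i′ → π ⟨$⟩ʳ i′ ≟ i) (+ k) (λ i′ → summand i′ l)
        i (π ⟨$⟩ˡ i) refl (λ _ eq → eq) (inverseʳ π)
        (λ i′ eq → trans (sym (inverseˡ π)) (cong (π ⟨$⟩ˡ_) eq)))

-- Affine independence of the blow-up.

-- The relation gives ∑ ∣ g ∣ = ∑ ∣ g ∘ π ∣ = (2 + k) ∑ ∣ g ∣.
permuted-multiple : ∀ {m} (π : Permutation′ m) k (g : Fin m → ℤ) →
                    (∀ i → + (2 + k) ℤ.* g i ℤ.+ g (π ⟨$⟩ʳ i) ≡ 0ℤ) → ∀ i → g i ≡ 0ℤ
permuted-multiple {m} π k g relation i =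
  ℤₚ.∣i∣≡0⇒i≡0 (ℕₚ.n≤0⇒n≡0 (subst (∣ g i ∣ ≤_) X≡0 (term≤∑ℕ (λ i → ∣ g i ∣) i)))
  where
  open ≡-Reasoning
  X = ∑ℕ (λ i → ∣ g i ∣)
  scaled : ∀ i → ∣ g (π ⟨$⟩ʳ i) ∣ ≡ (2 + k) * ∣ g i ∣
  scaled i = begin
    ∣ g (π ⟨$⟩ʳ i) ∣            ≡⟨ ℤₚ.∣-i∣≡∣i∣ (g (π ⟨$⟩ʳ i)) ⟨
    ∣ ℤ.- g (π ⟨$⟩ʳ i) ∣        ≡⟨ cong ∣_∣ (inverseˡ-unique (+ (2 + k) ℤ.* g i) (g (π ⟨$⟩ʳ i)) (relation i)) ⟨
    ∣ + (2 + k) ℤ.* g i ∣       ≡⟨ ℤₚ.abs-* (+ (2 + k)) (g i) ⟩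
    (2 + k) * ∣ g i ∣           ∎
  -- `(2 + k) * X` unfolds to the right side, so cancelling one `X` leaves 0 equal to `X + k * X`. A
  -- factor of at least 2 is essential: with factor 1, the values 1 and -1 on a 2-cycle satisfy the
  -- relation.
  X≡multiple : X + 0 ≡ X + (X + k * X)
  X≡multiple = begin
    X + 0                            ≡⟨ ℕₚ.+-identityʳ X ⟩
    X                                ≡⟨ Sumℕ.sum-permute (λ i → ∣ g i ∣) π ⟩
    ∑ℕ (λ i → ∣ g (π ⟨$⟩ʳ i) ∣)      ≡⟨ Sumℕ.sum-cong-≗ scaled ⟩
    ∑ℕ (λ i → (2 + k) * ∣ g i ∣)     ≡⟨ Sumℕ.*-distribˡ-sum (2 + k) (λ i → ∣ g i ∣) ⟨
    (2 + k) * X                      ∎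
  X≡0 : X ≡ 0
  X≡0 = ℕₚ.m+n≡0⇒m≡0 X (sym (ℕₚ.+-cancelˡ-≡ X _ _ X≡multiple))

combine-elim : ∀ {d m} (P : Fin (d * m) → Set) → (∀ j i → P (combine {d} {m} j i)) → ∀ x → P x
combine-elim {d} {m} P Pji x = subst P (combine-remQuot {d} m x) (uncurry Pji (remQuot {d} m x))

-- The vertex `zero` is the origin, so its coefficient drops out.
sum-blowUp : ∀ {d m} (π : Permutation′ m) k (S : Simplex d) (a : Fin (suc (d * m)) → ℤ) l i →
  sumℤ (suc (d * m)) (λ x → a x ℤ.* blowUp π k S x (combine l i)) ≡
  ∑ (λ j → (+ k ℤ.* a (suc (combine j i)) ℤ.+ a (suc (combine j (π ⟨$⟩ʳ i)))) ℤ.* edge S j l)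
sum-blowUp {d} {m} π k S a l i = begin
  a zero ℤ.* 0ℤ ℤ.+ sumℤ (d * m) (λ x → a (suc x) ℤ.* blowUp π k S (suc x) (combine l i))
    ≡⟨ cong₂ ℤ._+_ (ℤₚ.*-zeroʳ (a zero)) (sumℤ≡∑ (d * m) _) ⟩
  0ℤ ℤ.+ ∑ (λ x → a (suc x) ℤ.* blowUp π k S (suc x) (combine l i))
    ≡⟨ ℤₚ.+-identityˡ _ ⟩
  ∑ (λ x → a (suc x) ℤ.* blowUp π k S (suc x) (combine l i))
    ≡⟨ blowUp-combination π k S (a ∘ suc) l i ⟩
  ∑ (λ j → (+ k ℤ.* a (suc (combine j i)) ℤ.+ a (suc (combine j (π ⟨$⟩ʳ i)))) ℤ.* edge S j l) ∎
  where open ≡-Reasoning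

-- Independence of the edges, applied in each block, gives for every fixed `j` a relation along `π`
-- that forces the coefficients to vanish. The coefficient of the origin then follows from the total
-- being 0.
blowUp-isSimplex : ∀ {d m} (π : Permutation′ m) k (S : Simplex d) →
                   IsSimplex S → IsSimplex (blowUp π (2 + k) S)
blowUp-isSimplex {d} {m} π k S simplex a sum≡0 comb≡0 = λ where
    zero    → trans (sym (ℤₚ.+-identityʳ (a zero))) (trans (cong (λ z → a zero ℤ.+ z) (sym tail≡0)) sum≡0)
    (suc x) → coefficient≡0 x
  where
  coefficient≡0 : ∀ x → a (suc x) ≡ 0ℤ
  coefficient≡0 = combine-elim {d} {m} (λ x → a (suc x) ≡ 0ℤ) λ j i →
    permuted-multiple π k (λ i → a (suc (combine j i)))
      (λ i → edge-independent S simplex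
               (λ j → + (2 + k) ℤ.* a (suc (combine j i)) ℤ.+ a (suc (combine j (π ⟨$⟩ʳ i))))
               (λ l → trans (sym (sum-blowUp π (2 + k) S a l i)) (comb≡0 (combine l i))) j) i
  tail≡0 : sumℤ (d * m) (a ∘ suc) ≡ 0ℤ
  tail≡0 = trans (sumℤ≡∑ (d * m) _) (∑-zero _ coefficient≡0)

-- Emptiness of the blow-up.

-- If some coefficient is N, the point is that vertex; otherwise the zero block spreads along π to all
-- blocks, which makes the coefficient of the zero vertex N after all.
blowUp-isEmpty : ∀ {d m} {π : Permutation′ m} → Transitive π → ∀ k .{{_ : NonZero k}} (S : Simplex d) →
                 suc k < m → IsSimplex S → IsEmpty S → IsEmpty (blowUp π k S)
blowUp-isEmpty {d} {m} {π} transitive k S k+1<m simplex empty p (c , N≢0 , inHull) =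
  vertex (any? (λ x → c x ℕ.≟ N))
  where
  N = sumℕ (suc (d * m)) c

  b : Fin d → Fin m → ℕ
  b j i = c (suc (combine j i))

  coeff : Fin m → Fin d → ℕ
  coeff i j = k * b j i + b j (π ⟨$⟩ʳ i)

  Λ : Fin m → ℕ
  Λ i = ∑ℕ (λ j → b j i)

  ∑b≡∑Λ : ∑ℕ (c ∘ suc) ≡ ∑ℕ Λ
  ∑b≡∑Λ = trans (sumℕ-combine d (c ∘ suc)) (Sumℕ.∑-comm b)

  N≡ : N ≡ c zero + ∑ℕ Λ
  N≡ = cong (λ s → c zero + s) (trans (sumℕ≡∑ (d * m) (c ∘ suc)) ∑b≡∑Λ)

  ∑Λ≤N : ∑ℕ Λ ≤ N
  ∑Λ≤N = ℕₚ.≤-trans (ℕₚ.m≤n+m _ (c zero)) (ℕₚ.≤-reflexive (sym N≡))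

  ∑coeff : ∀ i → ∑ℕ (coeff i) ≡ k * Λ i + Λ (π ⟨$⟩ʳ i)
  ∑coeff i = trans (Sumℕ.∑-distrib-+ {d} _ _)
                   (cong (_+ Λ (π ⟨$⟩ʳ i)) (sym (Sumℕ.*-distribˡ-sum k (λ j → b j i))))

  ∑∑coeff : ∑ℕ (λ i → ∑ℕ (coeff i)) ≡ suc k * ∑ℕ Λ
  ∑∑coeff = begin
    ∑ℕ (λ i → ∑ℕ (coeff i))                         ≡⟨ Sumℕ.sum-cong-≗ ∑coeff ⟩
    ∑ℕ (λ i → k * Λ i + Λ (π ⟨$⟩ʳ i))               ≡⟨ Sumℕ.∑-distrib-+ {m} _ _ ⟩
    ∑ℕ (λ i → k * Λ i) + ∑ℕ (λ i → Λ (π ⟨$⟩ʳ i))    ≡⟨ cong₂ _+_ (Sumℕ.*-distribˡ-sum k Λ) (Sumℕ.sum-permute Λ π) ⟨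
    k * ∑ℕ Λ + ∑ℕ Λ                                 ≡⟨ ℕₚ.+-comm (k * ∑ℕ Λ) (∑ℕ Λ) ⟩
    suc k * ∑ℕ Λ                                    ∎
    where open ≡-Reasoning

  inBlock : ∀ i l → + N ℤ.* block p i l ≡ ∑ (λ j → + coeff i j ℤ.* edge S j l)
  inBlock i l = trans (inHull (combine l i)) (trans (sum-blowUp π k S (λ x → + c x) l i)
    (Sumℤ.sum-cong-≗ (λ j → cong (ℤ._* edge S j l) (embed j))))
    where
    embed : ∀ j → + k ℤ.* + b j i ℤ.+ + b j (π ⟨$⟩ʳ i) ≡ + coeff i j
    embed j = trans (cong (λ z → z ℤ.+ + b j (π ⟨$⟩ʳ i)) (sym (ℤₚ.pos-* k (b j i))))
                    (sym (ℤₚ.pos-+ (k * b j i) (b j (π ⟨$⟩ʳ i))))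

  -- Block `i` of `p` is a lattice point with edge coefficients `coeff i j` over `N`. Once their sum
  -- is at most `N`, it lies in the translated copy of `S`, where emptiness applies.
  blockEmpty : ∀ i → ∑ℕ (coeff i) ≤ N → (∀ j → coeff i j ≡ 0) ⊎ (∃[ j ] coeff i j ≡ N)
  blockEmpty i ≤N = edge-empty S simplex empty N (coeff i) (block p i) N≢0 ≤N (inBlock i)

  -- Pigeonhole: if all `m` blocks had weight at least `N`, the total, which is at most `suc k * N`,
  -- would reach `m * N`.
  smallBlock : ∃[ i ] ¬ (N ≤ ∑ℕ (coeff i))
  smallBlock = ¬∀⟶∃¬ m (λ i → N ≤ ∑ℕ (coeff i)) (λ i → N ℕ.≤? ∑ℕ (coeff i)) λ large →
    ℕₚ.<⇒≱ (ℕₚ.*-monoˡ-< N {{ℕ.≢-nonZero N≢0}} k+1<m) (begin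
      m * N                     ≤⟨ *-≤-∑ℕ (λ i → ∑ℕ (coeff i)) large ⟩
      ∑ℕ (λ i → ∑ℕ (coeff i))   ≡⟨ ∑∑coeff ⟩
      suc k * ∑ℕ Λ              ≤⟨ ℕₚ.*-monoʳ-≤ (suc k) ∑Λ≤N ⟩
      suc k * N                 ∎)
    where open ℕₚ.≤-Reasoning

  module _ (noFull : ¬ (∃[ x ] c x ≡ N)) where

    Vanishes : Fin m → Set
    Vanishes i = ∀ j → b j i ≡ 0

    small⇒vanishes : ∀ i → ¬ (N ≤ ∑ℕ (coeff i)) → Vanishes i
    small⇒vanishes i N≰ = [ vanish , contradict ]′ (blockEmpty i (ℕₚ.<⇒≤ (ℕₚ.≰⇒> N≰)))
      where
      vanish : (∀ j → coeff i j ≡ 0) → Vanishes i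
      vanish coeff≡0 j =
        -- The block's own weight enters `coeff` with the factor `k`, so `k` must be nonzero to
        -- conclude.
        [ (λ k≡0 → contradiction k≡0 (ℕ.≢-nonZero⁻¹ k)) , (λ b≡0 → b≡0) ]′
          (ℕₚ.m*n≡0⇒m≡0∨n≡0 k (ℕₚ.m+n≡0⇒m≡0 (k * b j i) (coeff≡0 j)))
      contradict : ∃[ j ] coeff i j ≡ N → Vanishes i
      contradict (j , full) = contradiction
        (ℕₚ.≤-trans (ℕₚ.≤-reflexive (sym full)) (term≤∑ℕ (coeff i) j)) N≰

    -- Once block `i` carries no weight, only the weight of `π ⟨$⟩ʳ i` enters `coeff i`. It is at
    -- most `N`, so emptiness applies again, and a coefficient equal to `N` would be a full `c x`.
    step : ∀ i → Vanishes i → Vanishes (π ⟨$⟩ʳ i)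
    step i vanishes = [ vanish , contradict ]′ (blockEmpty i sum≤N)
      where
      Λi≡0 : Λ i ≡ 0
      Λi≡0 = trans (Sumℕ.sum-cong-≗ vanishes) (Sumℕ.sum-replicate-zero d)
      sum≤N : ∑ℕ (coeff i) ≤ N
      sum≤N = begin
        ∑ℕ (coeff i)              ≡⟨ ∑coeff i ⟩
        k * Λ i + Λ (π ⟨$⟩ʳ i)    ≡⟨ cong (λ z → k * z + Λ (π ⟨$⟩ʳ i)) Λi≡0 ⟩
        k * 0 + Λ (π ⟨$⟩ʳ i)      ≡⟨ cong (_+ Λ (π ⟨$⟩ʳ i)) (ℕₚ.*-zeroʳ k) ⟩
        Λ (π ⟨$⟩ʳ i)              ≤⟨ term≤∑ℕ Λ (π ⟨$⟩ʳ i) ⟩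
        ∑ℕ Λ                      ≤⟨ ∑Λ≤N ⟩
        N                         ∎
        where open ℕₚ.≤-Reasoning
      vanish : (∀ j → coeff i j ≡ 0) → Vanishes (π ⟨$⟩ʳ i)
      vanish coeff≡0 j = ℕₚ.m+n≡0⇒n≡0 (k * b j i) (coeff≡0 j)
      contradict : ∃[ j ] coeff i j ≡ N → Vanishes (π ⟨$⟩ʳ i)
      contradict (j , full) = contradiction (suc (combine j (π ⟨$⟩ʳ i)) , (begin
        b j (π ⟨$⟩ʳ i)            ≡⟨ cong (_+ b j (π ⟨$⟩ʳ i)) (ℕₚ.*-zeroʳ k) ⟨
        k * 0 + b j (π ⟨$⟩ʳ i)    ≡⟨ cong (λ z → k * z + b j (π ⟨$⟩ʳ i)) (vanishes j) ⟨
        coeff i j                 ≡⟨ full ⟩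
        N                         ∎)) noFull
        where open ≡-Reasoning

    allVanish : ∀ i → Vanishes i
    allVanish = transitive Vanishes step (proj₁ smallBlock) (uncurry small⇒vanishes smallBlock)

    zeroFull : c zero ≡ N
    zeroFull = sym (trans N≡ (trans (cong (λ s → c zero + s) ∑Λ≡0) (ℕₚ.+-identityʳ (c zero))))
      where
      ∑Λ≡0 : ∑ℕ Λ ≡ 0
      ∑Λ≡0 = trans (Sumℕ.sum-cong-≗ λ i → trans (Sumℕ.sum-cong-≗ (allVanish i)) (Sumℕ.sum-replicate-zero d))
                   (Sumℕ.sum-replicate-zero m)

  vertex : Dec (∃[ x ] c x ≡ N) → ∃[ x ] (∀ y → blowUp π k S x y ≡ p y)
  vertex (no noFull) = contradiction (zero , zeroFull noFull) noFull
  -- A coefficient equal to the whole sum makes all others 0, so `N` times `p` is `N` times the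
  -- vertex `x`.
  vertex (yes (x , full)) = x , λ y → ℤₚ.*-cancelˡ-≡ (+ N) _ _ {{ℕ.≢-nonZero N≢0}} (begin
      + N ℤ.* T x y                                ≡⟨ cong (λ z → + z ℤ.* T x y) full ⟨
      + c x ℤ.* T x y                              ≡⟨ sum-only (λ z → + c z ℤ.* T z y) x (others≡0 y) ⟨
      ∑ (λ z → + c z ℤ.* T z y)                    ≡⟨ sumℤ≡∑ (suc (d * m)) (λ z → + c z ℤ.* T z y) ⟨
      sumℤ (suc (d * m)) (λ z → + c z ℤ.* T z y)   ≡⟨ inHull y ⟨
      + N ℤ.* p y                                  ∎)
    where
    open ≡-Reasoning
    T = blowUp π k S
    others≡0 : ∀ y z → z ≢ x → + c z ℤ.* T z y ≡ 0ℤ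
    others≡0 y z z≢x = trans
      (cong (λ s → + s ℤ.* T z y)
        (∑ℕ-full-term c x (trans full (sumℕ≡∑ (suc (d * m)) c)) z z≢x))
      (ℤₚ.*-zeroˡ (T z y))

-- Width of the blow-up.

-- All blocks share the origin. This labelling lifts the extremal vertices of `S` without asking
-- whether one of them is the base vertex.
blowUpVertex : ∀ {d m} → Fin m → Fin (suc d) → Fin (suc (d * m))
blowUpVertex i zero    = zero
blowUpVertex i (suc j) = suc (combine j i)

-- Values relative to the base vertex vanish at `zero`, so one formula covers the origin as well.
dot-blowUpVertex : ∀ {d m} (π : Permutation′ m) k (S : Simplex d) (f : Point (d * m)) i a →
  dot f (blowUp π k S (blowUpVertex i a)) ≡
  + k ℤ.* (dot (block f i) (S a) ℤ.- dot (block f i) (S zero)) ℤ.+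
  (dot (block f (π ⟨$⟩ˡ i)) (S a) ℤ.- dot (block f (π ⟨$⟩ˡ i)) (S zero))
dot-blowUpVertex {d} {m} π k S f i zero =
  trans (trans (sumℤ≡∑ (d * m) (λ y → f y ℤ.* 0ℤ)) (∑-zero _ (λ y → ℤₚ.*-zeroʳ (f y))))
        (sym (cancel (+ k) (dot (block f i) (S zero)) (dot (block f (π ⟨$⟩ˡ i)) (S zero))))
  where
  cancel : ∀ k x y → k ℤ.* (x ℤ.- x) ℤ.+ (y ℤ.- y) ≡ 0ℤ
  cancel = ℤ-Solver.solve-∀
dot-blowUpVertex π k S f i (suc j) = trans (dot-blowUp π k S f j i)
  (cong₂ (λ x y → + k ℤ.* x ℤ.+ y) (dot-edge (block f i) S j) (dot-edge (block f (π ⟨$⟩ˡ i)) S j))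

-- In the block i on which f has the largest range A, the multiple k A is perturbed by at most A.
blowUp-range : ∀ {d m} (π : Permutation′ (suc m)) n (S : Simplex d) w →
               (∀ g → NonZeroFunctional g → + w ℤ.≤ range g S) →
               ∀ f → NonZeroFunctional f → + (n * w) ℤ.≤ range f (blowUp π (suc n) S)
blowUp-range {d} {m} π n S w w≤range f (y , fy≢0) = begin
  + (n * w)                         ≡⟨ ℤₚ.pos-* n w ⟩
  + n ℤ.* + w                       ≤⟨ ℤₚ.*-monoˡ-≤-nonNeg (+ n) w≤A ⟩
  + n ℤ.* A                         ≡⟨ split (+ n) A ⟩
  (1ℤ ℤ.+ + n) ℤ.* A ℤ.- A          ≤⟨ ℤₚ.+-monoʳ-≤ ((1ℤ ℤ.+ + n) ℤ.* A) (ℤₚ.neg-mono-≤ B≤A) ⟩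
  (1ℤ ℤ.+ + n) ℤ.* A ℤ.- B          ≡⟨ cong (λ z → (1ℤ ℤ.+ + n) ℤ.* z ℤ.- B) A≡ ⟩
  (1ℤ ℤ.+ + n) ℤ.* (u a ℤ.- u b) ℤ.- (v b ℤ.- v a)
    -- The values at the base vertex cancel in the difference of the two lifted vertices.
    ≡⟨ telescope (1ℤ ℤ.+ + n) (u a) (u b) (u zero) (v a) (v b) (v zero) ⟩
  ((1ℤ ℤ.+ + n) ℤ.* (u a ℤ.- u zero) ℤ.+ (v a ℤ.- v zero)) ℤ.-
  ((1ℤ ℤ.+ + n) ℤ.* (u b ℤ.- u zero) ℤ.+ (v b ℤ.- v zero))
    ≡⟨ cong₂ ℤ._-_ (dot-blowUpVertex π (suc n) S f i a) (dot-blowUpVertex π (suc n) S f i b) ⟨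
  dot f (T (blowUpVertex i a)) ℤ.- dot f (T (blowUpVertex i b))
    ≤⟨ difference≤range f T (blowUpVertex i a) (blowUpVertex i b) ⟩
  range f T                         ∎
  where
  open ℤₚ.≤-Reasoning
  T = blowUp π (suc n) S
  blockRange : Fin (suc m) → ℤ
  blockRange i = range (block f i) S
  i = proj₁ (maxℤ-attained m blockRange)
  A = blockRange i
  range≤A : ∀ i′ → blockRange i′ ℤ.≤ A
  range≤A i′ = subst (blockRange i′ ℤ.≤_) (proj₂ (maxℤ-attained m blockRange)) (≤-maxℤ m blockRange i′)
  u v : Fin (suc d) → ℤ
  u c = dot (block f i) (S c)
  v c = dot (block f (π ⟨$⟩ˡ i)) (S c)
  a = proj₁ (range-attained (block f i) S)
  b = proj₁ (proj₂ (range-attained (block f i) S))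
  A≡ : A ≡ u a ℤ.- u b
  A≡ = proj₂ (proj₂ (range-attained (block f i) S))
  -- The order is reversed: in the worst case the neighbouring block runs against block `i` between
  -- the same two vertices.
  B = v b ℤ.- v a
  B≤A : B ℤ.≤ A
  B≤A = ℤₚ.≤-trans (difference≤range (block f (π ⟨$⟩ˡ i)) S b a) (range≤A (π ⟨$⟩ˡ i))
  w≤A : + w ℤ.≤ A
  -- The nonzero coordinate `y` lies in block `i₀`, so the restriction of `f` to that block is a
  -- nonzero functional.
  w≤A = ℤₚ.≤-trans (w≤range (block f i₀) (l₀ , fy≢0 ∘ trans (cong f (sym (combine-remQuot {d} (suc m) y)))))
                   (range≤A i₀)
    where
    l₀ = proj₁ (remQuot {d} (suc m) y)
    i₀ = proj₂ (remQuot {d} (suc m) y)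
  split : ∀ n A → n ℤ.* A ≡ (1ℤ ℤ.+ n) ℤ.* A ℤ.- A
  split = ℤ-Solver.solve-∀
  telescope : ∀ k ua ub u₀ va vb v₀ → k ℤ.* (ua ℤ.- ub) ℤ.- (vb ℤ.- va) ≡
              (k ℤ.* (ua ℤ.- u₀) ℤ.+ (va ℤ.- v₀)) ℤ.- (k ℤ.* (ub ℤ.- u₀) ℤ.+ (vb ℤ.- v₀))
  telescope = ℤ-Solver.solve-∀

-- From a bound on all ranges to a bound on the maximal width.

-- Strong induction: without a minimum no `n` can satisfy `P`. As `P` may be undecidable, only the
-- double negation results.
¬¬-minimum : (P : ℕ → Set) → ∃ P → ¬ ¬ (∃[ n ] (P n × (∀ k → P k → n ≤ k)))
¬¬-minimum P (n , Pn) noMin = <-rec (λ n → ¬ P n) smaller n Pn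
  where
  smaller : ∀ n → (∀ {k} → k < n → ¬ P k) → ¬ P n
  smaller n none Pn = noMin (n , Pn , λ k Pk → ℕₚ.≮⇒≥ (λ k<n → none k<n Pk))

¬¬-hasWidth : ∀ {d} → 1 ≤ d → (S : Simplex d) → ¬ ¬ (∃[ w ] HasWidth S w)
¬¬-hasWidth {suc d} _ S noWidth = ¬¬-minimum
  (λ w → ∃[ f ] (NonZeroFunctional f × range f S ≡ + w))
  -- The all-ones functional is nonzero in positive dimension, so there is a range to start from.
  (_ , (λ _ → 1ℤ) , (zero , λ ()) , range≡+∣range∣ (λ _ → 1ℤ) S)
  λ (w , attained , minimal) → noWidth (w , attained , λ f f≢0 →
    ℤₚ.≤-trans (ℤ.+≤+ (minimal ∣ range f S ∣ (f , f≢0 , range≡+∣range∣ f S)))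
               (ℤₚ.≤-reflexive (sym (range≡+∣range∣ f S))))

-- Constructively the width of S exists only up to ¬¬, which is enough because v ≤ W is decidable.
≤-maxEmptyWidth : ∀ {d W v} → 1 ≤ d → IsMaxEmptyWidth d W → (S : Simplex d) → IsSimplex S → IsEmpty S →
                  (∀ f → NonZeroFunctional f → + v ℤ.≤ range f S) → v ≤ W
≤-maxEmptyWidth {d} {W} {v} 1≤d (_ , maximal) S simplex empty v≤range =
  decidable-stable (v ℕ.≤? W) λ v≰W → ¬¬-hasWidth 1≤d S
    λ (w , width@((f , f≢0 , range≡w) , _)) → v≰W (ℕₚ.≤-trans
      (ℤₚ.drop‿+≤+ (ℤₚ.≤-trans (v≤range f f≢0) (ℤₚ.≤-reflexive range≡w)))
      (maximal S w simplex empty width))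

-- For `m` up to 3 the truncated factor is 0. For `m` equal to `4 + n` the blow-up uses `k` equal to
-- `2 + n`: the largest value with `suc k < m`, and at least 2 as independence requires. The width
-- factor `k - 1` is then `m ∸ 3`.
maxEmptyWidth-* : ∀ {d W W′} m → 1 ≤ d → 1 ≤ m → IsMaxEmptyWidth d W → IsMaxEmptyWidth (d * m) W′ →
                  (m ∸ 3) * W ≤ W′
maxEmptyWidth-* 1 _ _ _ _ = z≤n
maxEmptyWidth-* 2 _ _ _ _ = z≤n
maxEmptyWidth-* 3 _ _ _ _ = z≤n
maxEmptyWidth-* {W = W} m@(suc (suc (suc (suc n)))) 1≤d 1≤m
  ((S , simplex , empty , _ , W≤range) , _) isMax′ =
  ≤-maxEmptyWidth (ℕₚ.*-mono-≤ 1≤d 1≤m) isMax′ (blowUp π (2 + n) S)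
    (blowUp-isSimplex π n S simplex)
    (blowUp-isEmpty {π = π} (cycle-transitive _) (2 + n) S ℕₚ.≤-refl simplex empty)
    (blowUp-range π (suc n) S W W≤range)
  where
  π : Permutation′ m
  π = cycle _

-- Dimension one and the limit statements.

-- With range 0, `f` agrees at both endpoints. Cancelling its single nonzero coefficient identifies
-- them, and the coefficients 1 and -1 contradict independence.
segment-width-positive : ∀ (S : Simplex 1) → IsSimplex S → ∀ f → NonZeroFunctional f → range f S ≢ 0ℤ
segment-width-positive S simplex f (zero , f₀≢0) range≡0 with simplex sign refl relation zero
  where
  sign : Fin 2 → ℤ
  sign zero    = 1ℤ
  sign (suc _) = ℤ.- 1ℤ
  difference≤0 : ∀ a b → dot f (S a) ℤ.≤ dot f (S b)
  difference≤0 a b = ℤₚ.i-j≤0⇒i≤j (ℤₚ.≤-trans (difference≤range f S a b) (ℤₚ.≤-reflexive range≡0))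
  endpoints≡ : S zero zero ≡ S (suc zero) zero
  endpoints≡ = ℤₚ.*-cancelˡ-≡ (f zero) _ _ {{ℤ.≢-nonZero f₀≢0}}
    (trans (sym (ℤₚ.+-identityʳ _))
      (trans (ℤₚ.≤-antisym (difference≤0 zero (suc zero)) (difference≤0 (suc zero) zero))
             (ℤₚ.+-identityʳ _)))
  relation : ∀ j → sumℤ 2 (λ i → sign i ℤ.* S i j) ≡ 0ℤ
  relation zero = trans (cong (λ z → 1ℤ ℤ.* z ℤ.+ (ℤ.- 1ℤ ℤ.* S (suc zero) zero ℤ.+ 0ℤ)) endpoints≡)
                        (cancel (S (suc zero) zero))
    where
    cancel : ∀ s → 1ℤ ℤ.* s ℤ.+ (ℤ.- 1ℤ ℤ.* s ℤ.+ 0ℤ) ≡ 0ℤ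
    cancel = ℤ-Solver.solve-∀
... | ()

1≤maxEmptyWidth₁ : ∀ {W} → IsMaxEmptyWidth 1 W → 1 ≤ W
1≤maxEmptyWidth₁ {zero}  ((S , simplex , _ , (f , f≢0 , range≡0) , _) , _) =
  ⊥-elim (segment-width-positive S simplex f f≢0 range≡0)
1≤maxEmptyWidth₁ {suc W} _ = s≤s z≤n

-- The limits are stated without reals. After division, the second part says that `We d' / d'`
-- exceeds `We d / d - 1 / k` for arbitrarily large `d'`, so the limsup is at least the supremum,
-- the reverse being immediate. The third says that some `We d / d` exceeds `1 - 1 / k`.
theorem1p8 : (We : ℕ → ℕ) → (∀ d → 1 ≤ d → IsMaxEmptyWidth d (We d)) →
    (∀ d m → 1 ≤ d → 1 ≤ m → (m ∸ 3) * We d ≤ We (d * m))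
    × (∀ d k N → 1 ≤ d → 1 ≤ k →
    ∃[ d' ] (N ≤ d' × 1 ≤ d' × k * We d * d' < (k * We d' + d') * d))
    × (∀ k → 1 ≤ k → ∃[ d ] (1 ≤ d × k * d < k * We d + d))
theorem1p8 We isMax = product , limsup , limsup≥1
  where
  open ℕₚ.≤-Reasoning

  product : ∀ d m → 1 ≤ d → 1 ≤ m → (m ∸ 3) * We d ≤ We (d * m)
  product d m 1≤d 1≤m =
    maxEmptyWidth-* m 1≤d 1≤m (isMax d 1≤d) (isMax (d * m) (ℕₚ.*-mono-≤ 1≤d 1≤m))

  -- The product inequality without truncated subtraction.
  product′ : ∀ d m → 1 ≤ d → 1 ≤ m → m * We d ≤ 3 * We d + We (d * m)
  product′ d m 1≤d 1≤m = begin
    m * We d                      ≤⟨ ℕₚ.*-monoˡ-≤ (We d) (ℕₚ.m≤n+m∸n m 3) ⟩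
    (3 + (m ∸ 3)) * We d          ≡⟨ ℕₚ.*-distribʳ-+ (We d) 3 (m ∸ 3) ⟩
    3 * We d + (m ∸ 3) * We d     ≤⟨ ℕₚ.+-monoʳ-≤ (3 * We d) (product d m 1≤d 1≤m) ⟩
    3 * We d + We (d * m)         ∎

  limsup : ∀ d k N → 1 ≤ d → 1 ≤ k →
           ∃[ d' ] (N ≤ d' × 1 ≤ d' × k * We d * d' < (k * We d' + d') * d)
  limsup d@(suc _) k N 1≤d 1≤k = d * m , ℕₚ.≤-trans N≤m m≤dm , ℕₚ.≤-trans (s≤s z≤n) m≤dm , bound
    where
    w = We d
    -- The loss `3 * w / (d * m)` must stay below `1 / k`, for which `m` above `k * (3 * w)`
    -- suffices; adding `N` makes `d * m` large enough.
    m = suc (k * (3 * w) + N)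
    N≤m : N ≤ m
    N≤m = ℕₚ.m≤n⇒m≤1+n (ℕₚ.m≤n+m N (k * (3 * w)))
    m≤dm : m ≤ d * m
    m≤dm = ℕₚ.m≤n*m m d
    regroup : ∀ k w d m → k * w * (d * m) ≡ k * (m * w) * d
    regroup = ℕ-Solver.solve-∀
    bound : k * w * (d * m) < (k * We (d * m) + d * m) * d
    bound = begin-strict
      k * w * (d * m)                         ≡⟨ regroup k w d m ⟩
      k * (m * w) * d                         ≤⟨ ℕₚ.*-monoˡ-≤ d (ℕₚ.*-monoʳ-≤ k (product′ d m 1≤d (s≤s z≤n))) ⟩
      k * (3 * w + We (d * m)) * d            ≡⟨ cong (_* d) (ℕₚ.*-distribˡ-+ k (3 * w) (We (d * m))) ⟩
      (k * (3 * w) + k * We (d * m)) * d      <⟨ ℕₚ.*-monoˡ-< d (ℕₚ.+-monoˡ-< (k * We (d * m)) (s≤s (ℕₚ.m≤m+n (k * (3 * w)) N))) ⟩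
      (m + k * We (d * m)) * d                ≤⟨ ℕₚ.*-monoˡ-≤ d (ℕₚ.+-monoˡ-≤ (k * We (d * m)) m≤dm) ⟩
      (d * m + k * We (d * m)) * d            ≡⟨ cong (_* d) (ℕₚ.+-comm (d * m) (k * We (d * m))) ⟩
      (k * We (d * m) + d * m) * d            ∎

  limsup≥1 : ∀ k → 1 ≤ k → ∃[ d ] (1 ≤ d × k * d < k * We d + d)
  limsup≥1 k 1≤k = d , s≤s z≤n , bound
    where
    -- From `d ≤ 3 + We d` the loss after multiplying by `k` is `k * 3`, which must be less than
    -- `d`.
    d = suc (k * 3)
    d≤3+We : d ≤ 3 + We d
    d≤3+We = begin
      d                   ≤⟨ ℕₚ.m≤n+m∸n d 3 ⟩
      3 + (d ∸ 3)         ≡⟨ cong (λ z → 3 + z) (ℕₚ.*-identityʳ (d ∸ 3)) ⟨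
      3 + (d ∸ 3) * 1     ≤⟨ ℕₚ.+-monoʳ-≤ 3 (ℕₚ.*-monoʳ-≤ (d ∸ 3) (1≤maxEmptyWidth₁ (isMax 1 (s≤s z≤n)))) ⟩
      3 + (d ∸ 3) * We 1  ≤⟨ ℕₚ.+-monoʳ-≤ 3 (product 1 d (s≤s z≤n) (s≤s z≤n)) ⟩
      3 + We (1 * d)      ≡⟨ cong (λ z → 3 + We z) (ℕₚ.*-identityˡ d) ⟩
      3 + We d            ∎
    bound : k * d < k * We d + d
    bound = begin-strict
      k * d               ≤⟨ ℕₚ.*-monoʳ-≤ k d≤3+We ⟩
      k * (3 + We d)      ≡⟨ ℕₚ.*-distribˡ-+ k 3 (We d) ⟩
      k * 3 + k * We d    <⟨ ℕₚ.+-monoˡ-< (k * We d) (ℕₚ.n<1+n (k * 3)) ⟩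
      d + k * We d        ≡⟨ ℕₚ.+-comm d (k * We d) ⟩
      k * We d + d        ∎
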